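{- Let $\mathcal{T}_1$ and $\mathcal{T}_2$ be two distinct (vertex-disjoint) stacked components, each isomorphic to the graph specified in the context. If the new edge $\mathcal{E}$ joins a floor vertex of $\mathcal{T}_1$ to a floor vertex of $\mathcal{T}_2$, then $$\mathrm{diam}(\mathcal{T}_1+\mathcal{E}+\mathcal{T}_2)=\mathrm{ord}(\ell)+4,$$ where $\mathcal{T}_1+\mathcal{E}+\mathcal{T}_2$ is the disjoint union of $\mathcal{T}_1$ and $\mathcal{T}_2$ together with the edge $\mathcal{E}$.
   Context: Let $p$ be a prime with $p\equiv 71$ or $119\pmod{120}$, let $\ell=2$, and let $\mathrm{ord}(\ell)$ be the order, in the ideal class group of $\mathbb{Q}(\sqrt{ -p})$, of a prime ideal above $2$; it is an odd integer $\ge 3$. A stacked component $\mathcal{T}$ (a component of the supersingular $2$-isogeny graph over $\mathbb{F}_p$ after identifying curves up to $\overline{\mathbb{F}_p}$-isomorphism, regarded as a simple undirected graph) is, writing $L=\mathrm{ord}(\ell)$, labelled so that $V(\mathcal{T})=\{0,1,\dots,2L-1\}$ and $$E(\mathcal{T})=\{\{2i,2i+1\}:0\le i\le L-1\}\cup\{\{2i+1,2i+3\}:0\le i\le L-2\}\cup\{\{2L-1,1\}\}.$$ The floor vertices of $\mathcal{T}$ are the even vertices. The new edge $\mathcal{E}$ is the single edge coming from $2$-isogenies not defined over $\mathbb{F}_p$ that must be added to obtain the spine; its endpoints are always two distinct floor vertices. The diameter is the maximum graph distance between two vertices. -}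

module Defs where

open import Level using (Level; _⊔_; 0ℓ)
open import Algebra.Bundles using (CommutativeRing)
open import Data.Nat using (ℕ; zero; suc; _+_; _*_; _∸_; _≤_; _<_)
open import Data.Nat.DivMod using (_/_)
open import Data.Nat.Divisibility using (_∣_)
open import Data.Fin using (Fin; toℕ)
open import Data.Integer as ℤ using (ℤ; +_)
open import Data.Integer.Tactic.RingSolver using (solve-∀)
import Data.Integer.Properties as ℤ
open import Data.Product using (_×_; _,_; ∃-syntax)
open import Data.Sum using (_⊎_; inj₁; inj₂)
open import Data.Unit.Polymorphic using (⊤)
open import Function.Bundles using (_↔_; _⇔_; Inverse)
open import Relation.Binary.Construct.Closure.Symmetric using (SymClosure)
open import Relation.Binary.PropositionalEquality
  using (_≡_; trans; cong; cong₂; isEquivalence)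
open import Relation.Nullary using (¬_)
open import Relation.Unary using (Pred; _∈_; _∉_; _≐_)

module Ideals {c ℓ : Level} (R : CommutativeRing c ℓ) where
  open CommutativeRing R
    using (Carrier; _≈_; 0#; 1#)
    renaming (_+_ to _⊕_; _*_ to _⊛_)

  Subset : Set (Level.suc (c ⊔ ℓ))
  Subset = Pred Carrier (c ⊔ ℓ)

  record IsIdeal (I : Subset) : Set (c ⊔ ℓ) where
    field
      resp     : ∀ {x y} → x ≈ y → x ∈ I → y ∈ I
      0∈       : 0# ∈ I
      +-closed : ∀ {x y} → x ∈ I → y ∈ I → x ⊕ y ∈ I
      *-closed : ∀ r {x} → x ∈ I → r ⊛ x ∈ I

  record IsPrimeIdeal (P : Subset) : Set (c ⊔ ℓ) where
    field
      isIdeal : IsIdeal P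
      proper  : 1# ∉ P
      prime   : ∀ x y → x ⊛ y ∈ P → x ∈ P ⊎ y ∈ P

  -- The ideal product: all finite sums of products a ⊛ b.
  data _·_ (I J : Subset) : Subset where
    empty : ∀ {x} → x ≈ 0# → (I · J) x
    add   : ∀ {x y a b} → a ∈ I → b ∈ J → y ∈ (I · J) →
            x ≈ (a ⊛ b) ⊕ y → (I · J) x

  unitIdeal : Subset
  unitIdeal _ = ⊤

  _^ᴵ_ : Subset → ℕ → Subset
  I ^ᴵ zero  = unitIdeal
  I ^ᴵ suc n = I · (I ^ᴵ n)

  _⋆_ : Carrier → Subset → Subset
  (α ⋆ I) x = ∃[ y ] (y ∈ I × x ≈ α ⊛ y)

  -- Nonzero ideals I, J of a domain lie in the same ideal class
  -- iff αI = βJ for some nonzero α, β.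
  _∼_ : Subset → Subset → Set (c ⊔ ℓ)
  I ∼ J = ∃[ α ] ∃[ β ]
    (¬ (α ≈ 0#) × ¬ (β ≈ 0#) × (α ⋆ I) ≐ (β ⋆ J))

  record IsClassOrder (I : Subset) (n : ℕ) : Set (c ⊔ ℓ) where
    field
      positive : 1 ≤ n
      trivial  : (I ^ᴵ n) ∼ unitIdeal
      least    : ∀ k → 1 ≤ k → (I ^ᴵ k) ∼ unitIdeal → n ≤ k

-- For a prime p ≡ 3 (mod 4), the ring of integers of ℚ(√-p) is ℤ[ω] with
-- ω = (1 + √-p)/2, and the pair (a , b) stands for a + bω.
-- Since ω² = ω - m with m = (p + 1)/4, multiplication is as below.
-- The division is exact only when p ≡ 3 (mod 4).

module Quadratic (m : ℤ) where

  infixl 6 _⊕_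
  infixl 7 _⊛_

  _⊕_ _⊛_ : ℤ × ℤ → ℤ × ℤ → ℤ × ℤ
  (a , b) ⊕ (c , d) = (a ℤ.+ c , b ℤ.+ d)
  (a , b) ⊛ (c , d) =
    ( a ℤ.* c ℤ.- m ℤ.* (b ℤ.* d)
    , a ℤ.* d ℤ.+ b ℤ.* c ℤ.+ b ℤ.* d )

  ⊖_ : ℤ × ℤ → ℤ × ℤ
  ⊖ (a , b) = (ℤ.- a , ℤ.- b)

  private
    0′ 1′ : ℤ × ℤ
    0′ = (+ 0 , + 0)
    1′ = (+ 1 , + 0)

    assoc₁ : ∀ m a b c d e f →
      (a ℤ.* c ℤ.- m ℤ.* (b ℤ.* d)) ℤ.* e
        ℤ.- m ℤ.* ((a ℤ.* d ℤ.+ b ℤ.* c ℤ.+ b ℤ.* d) ℤ.* f)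
      ≡ a ℤ.* (c ℤ.* e ℤ.- m ℤ.* (d ℤ.* f))
        ℤ.- m ℤ.* (b ℤ.* (c ℤ.* f ℤ.+ d ℤ.* e ℤ.+ d ℤ.* f))
    assoc₁ = solve-∀

    assoc₂ : ∀ m a b c d e f →
      (a ℤ.* c ℤ.- m ℤ.* (b ℤ.* d)) ℤ.* f
        ℤ.+ (a ℤ.* d ℤ.+ b ℤ.* c ℤ.+ b ℤ.* d) ℤ.* e
        ℤ.+ (a ℤ.* d ℤ.+ b ℤ.* c ℤ.+ b ℤ.* d) ℤ.* f
      ≡ a ℤ.* (c ℤ.* f ℤ.+ d ℤ.* e ℤ.+ d ℤ.* f)
        ℤ.+ b ℤ.* (c ℤ.* e ℤ.- m ℤ.* (d ℤ.* f))
        ℤ.+ b ℤ.* (c ℤ.* f ℤ.+ d ℤ.* e ℤ.+ d ℤ.* f)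
    assoc₂ = solve-∀

    comm₁ : ∀ m a b c d →
      a ℤ.* c ℤ.- m ℤ.* (b ℤ.* d) ≡ c ℤ.* a ℤ.- m ℤ.* (d ℤ.* b)
    comm₁ = solve-∀

    comm₂ : ∀ a b c d →
      a ℤ.* d ℤ.+ b ℤ.* c ℤ.+ b ℤ.* d ≡ c ℤ.* b ℤ.+ d ℤ.* a ℤ.+ d ℤ.* b
    comm₂ = solve-∀

    distrib₁ : ∀ m a b c d e f →
      a ℤ.* (c ℤ.+ e) ℤ.- m ℤ.* (b ℤ.* (d ℤ.+ f))
      ≡ (a ℤ.* c ℤ.- m ℤ.* (b ℤ.* d)) ℤ.+ (a ℤ.* e ℤ.- m ℤ.* (b ℤ.* f))
    distrib₁ = solve-∀

    distrib₂ : ∀ a b c d e f →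
      a ℤ.* (d ℤ.+ f) ℤ.+ b ℤ.* (c ℤ.+ e) ℤ.+ b ℤ.* (d ℤ.+ f)
      ≡ (a ℤ.* d ℤ.+ b ℤ.* c ℤ.+ b ℤ.* d) ℤ.+ (a ℤ.* f ℤ.+ b ℤ.* e ℤ.+ b ℤ.* f)
    distrib₂ = solve-∀

    identity₁ : ∀ m a b → + 1 ℤ.* a ℤ.- m ℤ.* (+ 0 ℤ.* b) ≡ a
    identity₁ = solve-∀

    identity₂ : ∀ a b → + 1 ℤ.* b ℤ.+ + 0 ℤ.* a ℤ.+ + 0 ℤ.* b ≡ b
    identity₂ = solve-∀

    ⊕-comm : ∀ x y → x ⊕ y ≡ y ⊕ x
    ⊕-comm (a , b) (c , d) = cong₂ _,_ (ℤ.+-comm a c) (ℤ.+-comm b d)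

    ⊕-identityˡ : ∀ x → 0′ ⊕ x ≡ x
    ⊕-identityˡ (a , b) = cong₂ _,_ (ℤ.+-identityˡ a) (ℤ.+-identityˡ b)

    ⊖-inverseˡ : ∀ x → (⊖ x) ⊕ x ≡ 0′
    ⊖-inverseˡ (a , b) = cong₂ _,_ (ℤ.+-inverseˡ a) (ℤ.+-inverseˡ b)

    ⊛-comm : ∀ x y → x ⊛ y ≡ y ⊛ x
    ⊛-comm (a , b) (c , d) = cong₂ _,_ (comm₁ m a b c d) (comm₂ a b c d)

    ⊛-identityˡ : ∀ x → 1′ ⊛ x ≡ x
    ⊛-identityˡ (a , b) = cong₂ _,_ (identity₁ m a b) (identity₂ a b)

    distribˡ : ∀ x y z → x ⊛ (y ⊕ z) ≡ (x ⊛ y) ⊕ (x ⊛ z)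
    distribˡ (a , b) (c , d) (e , f) =
      cong₂ _,_ (distrib₁ m a b c d e f) (distrib₂ a b c d e f)

  commutativeRing : CommutativeRing 0ℓ 0ℓ
  commutativeRing = record
    { Carrier = ℤ × ℤ
    ; _≈_ = _≡_
    ; _+_ = _⊕_
    ; _*_ = _⊛_
    ; -_ = ⊖_
    ; 0# = 0′
    ; 1# = 1′
    ; isCommutativeRing = record
      { isRing = record
        { +-isAbelianGroup = record
          { isGroup = record
            { isMonoid = record
              { isSemigroup = record
                { isMagma = record
                  { isEquivalence = isEquivalence ; ∙-cong = cong₂ _⊕_ }
                ; assoc = λ (a , b) (c , d) (e , f) →
                    cong₂ _,_ (ℤ.+-assoc a c e) (ℤ.+-assoc b d f)
                }
              ; identity = ⊕-identityˡ ,
                  λ x → trans (⊕-comm x 0′) (⊕-identityˡ x)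
              }
            ; inverse = ⊖-inverseˡ ,
                λ x → trans (⊕-comm x (⊖ x)) (⊖-inverseˡ x)
            ; ⁻¹-cong = cong ⊖_
            }
          ; comm = ⊕-comm
          }
        ; *-cong = cong₂ _⊛_
        ; *-assoc = λ (a , b) (c , d) (e , f) →
            cong₂ _,_ (assoc₁ m a b c d e f) (assoc₂ m a b c d e f)
        ; *-identity = ⊛-identityˡ ,
            λ x → trans (⊛-comm x 1′) (⊛-identityˡ x)
        ; distrib = distribˡ , λ x y z →
            trans (⊛-comm (y ⊕ z) x)
              (trans (distribˡ x y z) (cong₂ _⊕_ (⊛-comm x y) (⊛-comm x z)))
        }
      ; *-comm = ⊛-comm
      }
    }

𝓞 : ℕ → CommutativeRing 0ℓ 0ℓ
𝓞 p = Quadratic.commutativeRing (+ ((p + 1) / 4))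

record PrimeAbove2 (p : ℕ) : Set₁ where
  open CommutativeRing (𝓞 p) using (1#) renaming (_+_ to _⊕_)
  open Ideals (𝓞 p)
  field
    ideal        : Subset
    isPrimeIdeal : IsPrimeIdeal ideal
    2∈           : 1# ⊕ 1# ∈ ideal

IsOrd : (p : ℕ) → PrimeAbove2 p → ℕ → Set
IsOrd p 𝔭 L = Ideals.IsClassOrder (𝓞 p) (PrimeAbove2.ideal 𝔭) L

record Graph : Set₁ where
  field
    Vertex : Set
    Adj    : Vertex → Vertex → Set
    symm   : ∀ {u v} → Adj u v → Adj v u
    irrefl : ∀ {v} → ¬ Adj v v

module _ (G : Graph) where
  open Graph G

  data Walk : Vertex → Vertex → ℕ → Set where
    stop : ∀ {v} → Walk v v 0
    step : ∀ {u v w n} → Adj u v → Walk v w n → Walk u w (suc n)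

  IsDistance : Vertex → Vertex → ℕ → Set
  IsDistance u v d = Walk u v d × (∀ n → Walk u v n → d ≤ n)

  -- Every pair is required to have a finite distance, so a disconnected
  -- graph has no diameter.
  IsDiameter : ℕ → Set
  IsDiameter D =
      (∃[ u ] ∃[ v ] IsDistance u v D)
    × (∀ u v → ∃[ d ] (IsDistance u v d × d ≤ D))

data StackedEdge (L : ℕ) : ℕ → ℕ → Set where
  vertical : ∀ i → i < L → StackedEdge L (2 * i) (2 * i + 1)
  surface  : ∀ i → suc i < L → StackedEdge L (2 * i + 1) (2 * i + 3)
  closing  : StackedEdge L (2 * L ∸ 1) 1

record StackedComponent (L : ℕ) : Set₁ where
  field
    graph : Graph
  open Graph graph public
  field
    labelling : Vertex ↔ Fin (2 * L)

  label : Vertex → ℕ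
  label v = toℕ (Inverse.to labelling v)

  field
    edges : ∀ u v → Adj u v ⇔ SymClosure (StackedEdge L) (label u) (label v)

  Floor : Vertex → Set
  Floor v = 2 ∣ label v

module _ (G H : Graph) (a : Graph.Vertex G) (b : Graph.Vertex H) where
  private
    module G = Graph G
    module H = Graph H

  data JoinAdj : G.Vertex ⊎ H.Vertex → G.Vertex ⊎ H.Vertex → Set where
    left  : ∀ {u v} → G.Adj u v → JoinAdj (inj₁ u) (inj₁ v)
    right : ∀ {u v} → H.Adj u v → JoinAdj (inj₂ u) (inj₂ v)
    new   : JoinAdj (inj₁ a) (inj₂ b)
    new⁻¹ : JoinAdj (inj₂ b) (inj₁ a)

  join : Graph
  join = record
    { Vertex = G.Vertex ⊎ H.Vertex
    ; Adj    = JoinAdj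
    ; symm   = λ { (left e)  → left (G.symm e)
                 ; (right e) → right (H.symm e)
                 ; new       → new⁻¹
                 ; new⁻¹     → new }
    ; irrefl = λ { (left e)  → G.irrefl e
                 ; (right e) → H.irrefl e }
    }

{-# OPTIONS --safe #-}
module Submission where

-- Each stacked component is a cycle of length L = 2k + 1 with a pendant floor
-- vertex at every cycle vertex, so two vertices of it are at distance at most
-- k + 2, and every floor vertex has an antipodal floor vertex at distance
-- exactly k + 2. A path between the two components has to use the new edge,
-- so the largest distance is (k + 2) + 1 + (k + 2) = L + 4.

open import Defs
open import Data.Fin using (toℕ; fromℕ<)
open import Data.Fin.Properties using (toℕ<n; toℕ-fromℕ<; toℕ-injective)
open import Data.Nat
open import Data.Nat.DivMod
open import Data.Nat.Divisibility using (_∣_; n∣m*n; m%n≡0⇒n∣m; n∣m⇒m%n≡0)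
open import Data.Nat.Primality using (Prime)
open import Data.Nat.Properties
open import Data.Nat.Tactic.RingSolver using (solve-∀)
open import Data.Product using (_×_; _,_; proj₁; swap; ∃-syntax)
open import Data.Sum using (_⊎_; inj₁; inj₂; [_,_]′)
open import Function.Base using (_∘_)
open import Function.Bundles using (Equivalence; Injection; Inverse)
open import Function.Properties.Inverse using (↔⇒↣)
open import Relation.Binary.Construct.Closure.Symmetric using (fwd; gfold)
open import Relation.Binary.PropositionalEquality hiding (J)
open import Relation.Nullary using (¬_; contradiction; yes; no)

-- Walks and distance functions

module _ (G : Graph) where
  open Graph G

  infixr 5 _++_
  _++_ : ∀ {u v w m n} → Walk G u v m → Walk G v w n → Walk G u w (m + n)
  stop     ++ q = q
  step e p ++ q = step e (p ++ q)

  reverse : ∀ {u v n} → Walk G u v n → Walk G v u n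
  reverse stop = stop
  reverse (step {n = n} e p) =
    subst (Walk G _ _) (+-comm n 1) (reverse p ++ step (symm e) stop)

  trivial-walk : ∀ {u v} → Walk G u v 0 → u ≡ v
  trivial-walk stop = refl

  -- A certificate for the distance to `v` that avoids enumerating walks: `lipschitz` and `zero-at`
  -- bound the length of every walk from below, and `walk` attains the bound.
  record IsDistanceTo (v : Vertex) (f : Vertex → ℕ) : Set where
    field
      zero-at   : f v ≡ 0
      lipschitz : ∀ {u w} → Adj u w → f u ≤ suc (f w)
      walk      : ∀ u → Walk G u v (f u)

    shortest : ∀ {u n} → Walk G u v n → f u ≤ n
    shortest stop       = ≤-reflexive zero-at
    shortest (step e p) = ≤-trans (lipschitz e) (s≤s (shortest p))

    isDistance : ∀ u → IsDistance G u v (f u)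
    isDistance u = walk u , λ _ → shortest

  distances : (d : Vertex → Vertex → ℕ) → Set
  distances d = ∀ v → IsDistanceTo v (λ u → d u v)

-- Two graphs joined by a bridge

module _ (G H : Graph) (a : Graph.Vertex G) (b : Graph.Vertex H) where
  private J = join G H a b

  walkˡ : ∀ {u v n} → Walk G u v n → Walk J (inj₁ u) (inj₁ v) n
  walkˡ stop       = stop
  walkˡ (step e p) = step (left e) (walkˡ p)

  walkʳ : ∀ {u v n} → Walk H u v n → Walk J (inj₂ u) (inj₂ v) n
  walkʳ stop       = stop
  walkʳ (step e p) = step (right e) (walkʳ p)

  module _ {f : Graph.Vertex G → ℕ} {g : Graph.Vertex H → ℕ} where
    open IsDistanceTo

    -- The new edge is a bridge, so a walk from `H` to `v` must reach `b`, cross to `a` and go on to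
    -- `v` inside `G`.
    join-distanceˡ : ∀ {v} → IsDistanceTo G v f → IsDistanceTo H b g →
      IsDistanceTo J (inj₁ v) [ f , (λ w → g w + suc (f a)) ]′
    join-distanceˡ F K .zero-at = F .zero-at
    join-distanceˡ F K .lipschitz (left e)  = F .lipschitz e
    join-distanceˡ F K .lipschitz (right e) = +-monoˡ-≤ (suc (f a)) (K .lipschitz e)
    -- This crossing leads away from the target, so the inequality has room to spare; the return
    -- crossing is the tight case.
    join-distanceˡ F K .lipschitz new =
      m≤n⇒m≤1+n (≤-trans (n≤1+n (f a)) (m≤n+m (suc (f a)) (g b)))
    join-distanceˡ F K .lipschitz new⁻¹ =
      ≤-reflexive (cong (_+ suc (f a)) (K .zero-at))
    join-distanceˡ F K .walk (inj₁ u) = walkˡ (F .walk u)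
    join-distanceˡ F K .walk (inj₂ w) =
      _++_ J (walkʳ (K .walk w)) (step new⁻¹ (walkˡ (F .walk a)))

    join-distanceʳ : ∀ {v} → IsDistanceTo G a f → IsDistanceTo H v g →
      IsDistanceTo J (inj₂ v) [ (λ u → f u + suc (g b)) , g ]′
    join-distanceʳ F K .zero-at = K .zero-at
    join-distanceʳ F K .lipschitz (left e)  = +-monoˡ-≤ (suc (g b)) (F .lipschitz e)
    join-distanceʳ F K .lipschitz (right e) = K .lipschitz e
    join-distanceʳ F K .lipschitz new =
      ≤-reflexive (cong (_+ suc (g b)) (F .zero-at))
    join-distanceʳ F K .lipschitz new⁻¹ =
      m≤n⇒m≤1+n (≤-trans (n≤1+n (g b)) (m≤n+m (suc (g b)) (f a)))
    join-distanceʳ F K .walk (inj₁ u) =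
      _++_ J (walkˡ (F .walk u)) (step new (walkʳ (K .walk b)))
    join-distanceʳ F K .walk (inj₂ w) = walkʳ (K .walk w)

  -- Pairs on one side are within `D` of each other, and pairs on opposite sides within `D + 1 + D`.
  -- The bound is attained by joining a vertex farthest from `a` to one farthest from `b`.
  join-diameter : ∀ {d e D} → distances G d → distances H e →
    (∀ u v → d u v ≤ D) → (∀ u v → e u v ≤ D) →
    (∃[ u ] d u a ≡ D) → (∃[ v ] e b v ≡ D) →
    IsDiameter J (D + suc D)
  join-diameter {d} {e} {D} δ ε d≤ e≤ (u , du≡D) (v , ev≡D) =
    ( inj₁ u , inj₂ v
    , subst (IsDistance J (inj₁ u) (inj₂ v))
        (cong₂ (λ m n → m + suc n) du≡D ev≡D)
        (IsDistanceTo.isDistance (join-distanceʳ (δ a) (ε v)) (inj₁ u)) ) ,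
    λ { (inj₁ y) (inj₁ x) → toˡ x (inj₁ y) (≤-trans (d≤ y x) (m≤m+n D (suc D)))
      ; (inj₂ y) (inj₁ x) → toˡ x (inj₂ y) (+-mono-≤ (e≤ y b) (s≤s (d≤ a x)))
      ; (inj₁ y) (inj₂ x) → toʳ x (inj₁ y) (+-mono-≤ (d≤ y a) (s≤s (e≤ b x)))
      ; (inj₂ y) (inj₂ x) → toʳ x (inj₂ y) (≤-trans (e≤ y x) (m≤m+n D (suc D)))
      }
    where
    toˡ : ∀ x w → _ → ∃[ n ] (IsDistance J w (inj₁ x) n × n ≤ D + suc D)
    toˡ x w bound =
      _ , IsDistanceTo.isDistance (join-distanceˡ (δ x) (ε b)) w , bound
    toʳ : ∀ x w → _ → ∃[ n ] (IsDistance J w (inj₂ x) n × n ≤ D + suc D)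
    toʳ x w bound =
      _ , IsDistanceTo.isDistance (join-distanceʳ (δ a) (ε x)) w , bound

-- Arithmetic of distances on a cycle and its pendant vertices

-- A pair of inequalities, so that `swap` is its symmetry and undirected edges need checking in one
-- orientation only.
Near : ℕ → ℕ → Set
Near m n = m ≤ suc n × n ≤ suc m

near-suc : ∀ {m n} → Near m n → Near (suc m) (suc n)
near-suc (m≤ , n≤) = s≤s m≤ , s≤s n≤

near-1+ : ∀ n → Near (suc n) n
near-1+ n = ≤-refl , m≤n⇒m≤1+n (n≤1+n n)

-- The shorter way round a cycle of length `L` between vertices whose positions differ by `d`.
fold : ℕ → ℕ → ℕ
fold L d = d ⊓ (L ∸ d)

fold-suc : ∀ L d → Near (fold L (suc d)) (fold L d)
fold-suc L d =
  ⊓-mono-≤ ≤-refl (≤-trans (∸-monoʳ-≤ L (n≤1+n d)) (n≤1+n (L ∸ d))) ,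
  ⊓-mono-≤ (m≤n⇒m≤1+n (n≤1+n d)) step-down
  where
  step-down : L ∸ d ≤ suc (L ∸ suc d)
  step-down = m≤n+o⇒m∸n≤o L d
    (subst (L ≤_) (sym (+-suc d (L ∸ suc d))) (m≤n+m∸n L (suc d)))

fold-sym : ∀ {L d} → d ≤ L → fold L (L ∸ d) ≡ fold L d
fold-sym {L} {d} d≤L =
  trans (cong ((L ∸ d) ⊓_) (m∸[m∸n]≡n d≤L)) (⊓-comm (L ∸ d) d)

-- Either `d` is at most `k`, or it is at least `k + 1` and leaves at most `k` for the other way
-- round.
fold≤half : ∀ k d → fold (suc (2 * k)) d ≤ k
fold≤half k d with d ≤? k
... | yes d≤k = ≤-trans (m⊓n≤m d _) d≤k
... | no  d≰k = ≤-trans (m⊓n≤n d _) (m≤n+o⇒m∸n≤o (suc (2 * k)) d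
  (≤-trans (≤-reflexive (cong (λ n → suc (k + n)) (+-identityʳ k)))
    (+-monoˡ-≤ k (≰⇒> d≰k))))

2k+1∸k≡k+1 : ∀ k → suc (2 * k) ∸ k ≡ suc k
2k+1∸k≡k+1 k = trans (cong (_∸ k) (odd k)) (m+n∸m≡n k (suc k))
  where
  odd : ∀ k → suc (2 * k) ≡ k + suc k
  odd = solve-∀

fold-half : ∀ k → fold (suc (2 * k)) k ≡ k
fold-half k = m≤n⇒m⊓n≡m (subst (k ≤_) (sym (2k+1∸k≡k+1 k)) (n≤1+n k))

arc : ℕ → ℕ → ℕ → ℕ
arc L i j = fold L ∣ i - j ∣

arc-comm : ∀ L i j → arc L i j ≡ arc L j i
arc-comm L i j = cong (fold L) (∣-∣-comm i j)

∣suc-∣ : ∀ i j → ∣ suc i - j ∣ ≡ suc ∣ i - j ∣ ⊎ ∣ i - j ∣ ≡ suc ∣ suc i - j ∣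
∣suc-∣ zero    zero    = inj₁ refl
∣suc-∣ zero    (suc j) = inj₂ refl
∣suc-∣ (suc i) zero    = inj₁ refl
∣suc-∣ (suc i) (suc j) = ∣suc-∣ i j

arc-suc : ∀ L i j → Near (arc L (suc i) j) (arc L i j)
arc-suc L i j with ∣suc-∣ i j
... | inj₁ eq = subst (λ d → Near (fold L d) (arc L i j)) (sym eq) (fold-suc L _)
... | inj₂ eq = subst (λ d → Near (arc L (suc i) j) (fold L d)) (sym eq)
                  (swap (fold-suc L _))

-- Position `m` is `m ∸ j` away from `j`; going from 0 to `j` through the closing edge costs one
-- step more, and `fold-sym` identifies that way round with the direct one.
arc-wrap : ∀ m j → j < suc m → Near (arc (suc m) m j) (arc (suc m) 0 j)
arc-wrap m j (s≤s j≤m) = subst₂ (λ x y → Near (fold (suc m) x) y)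
  (sym (m≤n⇒∣n-m∣≡n∸m j≤m))
  (trans (cong (fold (suc m)) (sym (+-∸-assoc 1 j≤m))) (fold-sym (m≤n⇒m≤1+n j≤m)))
  (swap (fold-suc (suc m) (m ∸ j)))

-- Moves `k` positions up when `j ≤ k`, and otherwise `k + 1` positions down, which is `k` the other
-- way round.
antipode : ∀ k j → j < suc (2 * k) →
  ∃[ i ] (i < suc (2 * k) × arc (suc (2 * k)) i j ≡ k)
antipode k j (s≤s j≤2k) with j ≤? k
... | yes j≤k =
  j + k , s≤s (subst (j + k ≤_) (cong (k +_) (sym (+-identityʳ k))) (+-monoˡ-≤ k j≤k)) ,
  trans (cong (fold _) (trans (∣-∣-comm (j + k) j) (∣m-m+n∣≡n j k))) (fold-half k)
... | no  j≰k with i , refl ← m≤n⇒∃[o]m+o≡n (≰⇒> j≰k) =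
  i , s≤s (≤-trans (m≤n+m i (suc k)) j≤2k) ,
  trans (cong (fold _) (trans (cong ∣ i -_∣ (+-comm (suc k) i)) (∣m-m+n∣≡n i (suc k))))
    (trans (cong (fold _) (sym (2k+1∸k≡k+1 k)))
      (trans (fold-sym (m≤n⇒m≤1+n (m≤m+n k (k + 0)))) (fold-half k)))

-- The distance between vertices of heights h and h′ (0 on the floor, positive
-- on the cycle) whose cycle vertices are at distance c.
link : ℕ → ℕ → ℕ → ℕ
link zero    zero     zero    = 0
link zero    zero     (suc c) = 3 + c
link zero    (suc h′) c       = suc c
link (suc h) zero     c       = suc c
link (suc h) (suc h′) c       = c

link-diagonal : ∀ h → link h h 0 ≡ 0
link-diagonal zero    = refl
link-diagonal (suc h) = refl

link≤ : ∀ h h′ c → link h h′ c ≤ 2 + c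
link≤ zero    zero     zero    = z≤n
link≤ zero    zero     (suc c) = ≤-refl
link≤ zero    (suc h′) c       = n≤1+n _
link≤ (suc h) zero     c       = n≤1+n _
link≤ (suc h) (suc h′) c       = ≤-trans (n≤1+n c) (n≤1+n (suc c))

link-floors : ∀ {c} → 1 ≤ c → link 0 0 c ≡ 2 + c
link-floors (s≤s _) = refl

link-vertical : ∀ h c → Near (link 0 h c) (link 1 h c)
link-vertical zero    zero    = z≤n , s≤s z≤n
link-vertical zero    (suc c) = near-1+ (2 + c)
link-vertical (suc h) c       = near-1+ c

link-surface : ∀ {c c′} h → Near c c′ → Near (link 1 h c) (link 1 h c′)
link-surface zero    = near-suc
link-surface (suc h) near = near

-- Distance as a function of the labels

floor%2 : ∀ i → (2 * i) % 2 ≡ 0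
floor%2 i = trans (cong (_% 2) (*-comm 2 i)) (m*n%n≡0 i 2)

floor/2 : ∀ i → (2 * i) / 2 ≡ i
floor/2 i = trans (cong (_/ 2) (*-comm 2 i)) (m*n/n≡m i 2)

odd-form : ∀ i → 2 * i + 1 ≡ 1 + i * 2
odd-form = solve-∀

surface%2 : ∀ i → (2 * i + 1) % 2 ≡ 1
surface%2 i = trans (cong (_% 2) (odd-form i)) ([m+kn]%n≡m%n 1 i 2)

surface/2 : ∀ i → (2 * i + 1) / 2 ≡ i
surface/2 i = trans (cong (_/ 2) (odd-form i))
  (trans (+-distrib-/-∣ʳ 1 {d = 2} (n∣m*n i)) (m*n/n≡m i 2))

surface-suc : ∀ i → 2 * i + 3 ≡ 2 * suc i + 1
surface-suc = solve-∀

surface-last : ∀ m → 2 * suc m ∸ 1 ≡ 2 * m + 1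
surface-last m = trans (+-suc m (m + 0)) (+-comm 1 (m + (m + 0)))

-- Labels `2 * i` and `2 * i + 1` are the floor vertex and the cycle vertex at position `i`, so the
-- remainder mod 2 is the height and the quotient the position.
labelDistance : ℕ → ℕ → ℕ → ℕ
labelDistance L l n = link (l % 2) (n % 2) (arc L (l / 2) (n / 2))

labelDistance-floor : ∀ L i n →
  labelDistance L (2 * i) n ≡ link 0 (n % 2) (arc L i (n / 2))
labelDistance-floor L i n =
  cong₂ (λ h x → link h (n % 2) (arc L x (n / 2))) (floor%2 i) (floor/2 i)

labelDistance-surface : ∀ L i n →
  labelDistance L (2 * i + 1) n ≡ link 1 (n % 2) (arc L i (n / 2))
labelDistance-surface L i n =
  cong₂ (λ h x → link h (n % 2) (arc L x (n / 2))) (surface%2 i) (surface/2 i)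

half< : ∀ {n L} → n < 2 * L → n / 2 < L
half< {n} {L} n<2L = m<n*o⇒m/o<n {n} {L} {2} (subst (n <_) (*-comm 2 L) n<2L)

-- A vertical edge changes only the height, a surface edge moves the position by one, and the
-- closing edge wraps it from the last position to 0.
labelDistance-edge : ∀ {L l l′ n} → n < 2 * L → StackedEdge L l l′ →
  Near (labelDistance L l n) (labelDistance L l′ n)
labelDistance-edge {L} {n = n} _ (vertical i _) =
  subst₂ Near (sym (labelDistance-floor L i n)) (sym (labelDistance-surface L i n))
    (link-vertical (n % 2) (arc L i (n / 2)))
labelDistance-edge {L} {n = n} _ (surface i _) =
  subst₂ Near (sym (labelDistance-surface L i n))
    (sym (trans (cong (λ l → labelDistance L l n) (surface-suc i))
      (labelDistance-surface L (suc i) n)))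
    (link-surface (n % 2) (swap (arc-suc L i (n / 2))))
labelDistance-edge {suc m} {n = n} n<2L closing =
  subst₂ Near
    (sym (trans (cong (λ l → labelDistance (suc m) l n) (surface-last m))
      (labelDistance-surface (suc m) m n)))
    (sym (labelDistance-surface (suc m) 0 n))
    (link-surface (n % 2) (arc-wrap m (n / 2) (half< n<2L)))
labelDistance-edge {zero} () closing

-- Shortest walks in a stacked component

module Component {L : ℕ} (T : StackedComponent L) where
  open StackedComponent T

  label<2L : ∀ v → label v < 2 * L
  label<2L v = toℕ<n (Inverse.to labelling v)

  label-injective : ∀ {u v} → label u ≡ label v → u ≡ v
  label-injective = Injection.injective (↔⇒↣ labelling) ∘ toℕ-injective

  vertex : ∀ {l} → l < 2 * L → Vertex
  vertex l<2L = Inverse.from labelling (fromℕ< l<2L)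

  label-vertex : ∀ {l} (l<2L : l < 2 * L) → label (vertex l<2L) ≡ l
  label-vertex l<2L = trans
    (cong toℕ (Inverse.strictlyInverseˡ labelling (fromℕ< l<2L)))
    (toℕ-fromℕ< l<2L)

  position height : Vertex → ℕ
  position v = label v / 2
  height   v = label v % 2

  position<L : ∀ v → position v < L
  position<L v = half< (label<2L v)

  -- The equation for the height lets `link` compute after a rewrite in `distWalk`; the equation for
  -- the label has the shape of the edge endpoints.
  data View (v : Vertex) : Set where
    floor   : height v ≡ 0 → label v ≡ 2 * position v → View v
    surface : height v ≡ 1 → label v ≡ 2 * position v + 1 → View v

  view : ∀ v → View v
  view v with label v % 2 in eq | m≡m%n+[m/n]*n (label v) 2 | m%n<n (label v) 2
  ... | 0 | l≡ | _ = floor eq (trans l≡ (*-comm (position v) 2))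
  ... | 1 | l≡ | _ = surface eq (trans l≡ (sym (odd-form (position v))))
  ... | suc (suc _) | _ | s≤s (s≤s ())

  floorAt : ∀ i → i < L → ∃[ v ] label v ≡ 2 * i
  floorAt i i<L = vertex (*-monoʳ-< 2 i<L) , label-vertex (*-monoʳ-< 2 i<L)

  surfaceAt : ∀ i → i < L → ∃[ v ] label v ≡ 2 * i + 1
  surfaceAt i i<L = vertex bound , label-vertex bound
    where
    bound : 2 * i + 1 < 2 * L
    bound = subst (_≤ 2 * L) (eq i) (*-monoʳ-≤ 2 i<L)
      where
      eq : ∀ i → 2 * suc i ≡ suc (2 * i + 1)
      eq = solve-∀

  edge : ∀ {u v l l′} → label u ≡ l → label v ≡ l′ → StackedEdge L l l′ → Adj u v
  edge refl refl e = Equivalence.from (edges _ _) (fwd e)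

  forwardWalk : ∀ {u v i j} d → i + d ≡ j → j < L →
    label u ≡ 2 * i + 1 → label v ≡ 2 * j + 1 → Walk graph u v d
  forwardWalk {u} {v} {i} zero i+0≡j _ lu lv =
    subst (λ w → Walk graph u w 0) (label-injective (trans lu (trans
      (cong (λ x → 2 * x + 1) (trans (sym (+-identityʳ i)) i+0≡j)) (sym lv)))) stop
  forwardWalk {i = i} {j} (suc d) eq j<L lu lv =
    let eq′ = trans (sym (+-suc i d)) eq
        si<L = ≤-<-trans (subst (suc i ≤_) eq′ (m≤m+n (suc i) d)) j<L
        w , lw = surfaceAt (suc i) si<L
    in step (edge lu (trans lw (sym (surface-suc i))) (surface i si<L))
         (forwardWalk d eq′ j<L lw lv)

  -- Goes down `i` steps to position 0, over the closing edge to the last position `i + d + e`, and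
  -- down `e` steps to `i + d`.
  backwardWalk : ∀ {u v i} d e → suc (i + d + e) ≡ L →
    label u ≡ 2 * i + 1 → label v ≡ 2 * (i + d) + 1 → Walk graph u v (i + suc e)
  backwardWalk {i = i} d e refl lu lv =
    let o , lo = surfaceAt 0 (s≤s z≤n)
        t , lt = surfaceAt (i + d + e) ≤-refl
        i<L = s≤s (≤-trans (m≤m+n i d) (m≤m+n (i + d) e))
        closing-edge = edge (trans lt (sym (surface-last (i + d + e)))) lo closing
    in _++_ graph (reverse graph (forwardWalk i refl i<L lo lu))
         (step (symm closing-edge) (reverse graph (forwardWalk e refl ≤-refl lv lt)))

  arcWalk-≤ : ∀ {u v i j} → i ≤ j → j < L →
    label u ≡ 2 * i + 1 → label v ≡ 2 * j + 1 → Walk graph u v (arc L i j)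
  arcWalk-≤ {u} {v} {i} i≤j j<L lu lv
    with d , refl ← m≤n⇒∃[o]m+o≡n i≤j | e , L≡ ← m≤n⇒∃[o]m+o≡n j<L
    -- The minimum equals one of its two arguments, and this decides which way round to walk.
    with ⊓-sel ∣ i - i + d ∣ (L ∸ ∣ i - i + d ∣)
  ... | inj₁ eq = subst (Walk graph u v) (sym (trans eq (∣m-m+n∣≡n i d)))
                    (forwardWalk d refl j<L lu lv)
  ... | inj₂ eq = subst (Walk graph u v) (sym (trans eq complement))
                    (backwardWalk d e L≡ lu lv)
    where
    rearrange : ∀ i d e → suc (i + d + e) ≡ d + (i + suc e)
    rearrange = solve-∀
    complement : L ∸ ∣ i - i + d ∣ ≡ i + suc e
    complement = trans (cong₂ _∸_ (trans (sym L≡) (rearrange i d e)) (∣m-m+n∣≡n i d))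
      (m+n∸m≡n d (i + suc e))

  arcWalk : ∀ {u v i j} → i < L → j < L →
    label u ≡ 2 * i + 1 → label v ≡ 2 * j + 1 → Walk graph u v (arc L i j)
  arcWalk {u} {v} {i} {j} i<L j<L lu lv with ≤-total i j
  ... | inj₁ i≤j = arcWalk-≤ i≤j j<L lu lv
  ... | inj₂ j≤i = subst (Walk graph u v) (arc-comm L j i)
                     (reverse graph (arcWalk-≤ j≤i i<L lv lu))

  dist : Vertex → Vertex → ℕ
  dist u v = labelDistance L (label u) (label v)

  climb : ∀ {v} → label v ≡ 2 * position v →
    ∃[ w ] (label w ≡ 2 * position v + 1 × Adj v w)
  climb {v} lv =
    let w , lw = surfaceAt (position v) (position<L v)
    in w , lw , edge lv lw (vertical (position v) (position<L v))

  distWalk : ∀ u v → Walk graph u v (dist u v)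
  distWalk u v with view u | view v
  ... | surface hu lu | surface hv lv rewrite hu | hv =
    arcWalk (position<L u) (position<L v) lu lv
  ... | floor hu lu | surface hv lv rewrite hu | hv =
    let x , lx , ux = climb lu
    in step ux (arcWalk (position<L u) (position<L v) lx lv)
  ... | surface hu lu | floor hv lv rewrite hu | hv =
    let y , ly , vy = climb lv
    in subst (Walk graph u v) (+-comm _ 1)
         (_++_ graph (arcWalk (position<L u) (position<L v) lu ly) (step (symm vy) stop))
  ... | floor hu lu | floor hv lv rewrite hu | hv
    with x , lx , ux ← climb lu | y , ly , vy ← climb lv
    -- The arc and its walk are abstracted together: `link` treats arc 0 separately, where the empty
    -- walk shows that both floor vertices hang from the same cycle vertex and hence coincide.
    with arc L (position u) (position v) | arcWalk (position<L u) (position<L v) lx ly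
  ... | zero  | p = subst (λ w → Walk graph u w 0) u≡v stop
    where
    positions : 2 * position u ≡ 2 * position v
    positions = +-cancelʳ-≡ 1 _ _
      (trans (sym lx) (trans (cong label (trivial-walk graph p)) ly))
    u≡v : u ≡ v
    u≡v = label-injective (trans lu (trans positions (sym lv)))
  ... | suc c | p = subst (Walk graph u v) (cong suc (+-comm (suc c) 1))
                      (step ux (_++_ graph p (step (symm vy) stop)))

  dist-self : ∀ v → dist v v ≡ 0
  dist-self v = trans
    (cong (λ d → link (height v) (height v) (fold L d)) (∣n-n∣≡0 (position v)))
    (link-diagonal (height v))

  dist-distances : distances graph dist
  dist-distances v = record
    { zero-at   = dist-self v
    -- `gfold` extends the check on oriented edges to their symmetric closure.
    ; lipschitz = λ {u} {w} e → proj₁ (gfold {S = Near} swap (λ l → labelDistance L l (label v))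
                    (labelDistance-edge (label<2L v)) (Equivalence.to (edges u w) e))
    ; walk      = λ u → distWalk u v
    }

-- Farthest floor vertices for odd cycle length

module OddComponent {k : ℕ} (1≤k : 1 ≤ k) (T : StackedComponent (suc (2 * k))) where
  open StackedComponent T
  open Component T

  dist≤ : ∀ u v → dist u v ≤ 2 + k
  dist≤ u v = ≤-trans (link≤ (height u) (height v) _)
    (+-monoʳ-≤ 2 (fold≤half k ∣ position u - position v ∣))

  -- As `1≤k`, the two floor vertices hang from different cycle vertices, so each end adds one step
  -- to the arc.
  dist-antipodal : ∀ {u v} → height u ≡ 0 → height v ≡ 0 →
    arc (suc (2 * k)) (position u) (position v) ≡ k → dist u v ≡ 2 + k
  dist-antipodal hu hv eq rewrite hu | hv | eq = link-floors 1≤k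

  -- Both argument orders are given because `join-diameter` asks for the distance to `a` on one side
  -- and from `b` on the other.
  farthest : ∀ v → Floor v → ∃[ u ] (dist u v ≡ 2 + k × dist v u ≡ 2 + k)
  farthest v fv =
    let i , i<L , arc≡k = antipode k (position v) (position<L v)
        u , lu = floorAt i i<L
        hu = trans (cong (_% 2) lu) (floor%2 i)
        hv = n∣m⇒m%n≡0 (label v) 2 fv
        pu = trans (cong (_/ 2) lu) (floor/2 i)
        uv = trans (cong (λ x → arc (suc (2 * k)) x (position v)) pu) arc≡k
    in u , dist-antipodal {u} {v} hu hv uv ,
       dist-antipodal {v} {u} hv hu (trans (arc-comm _ (position v) (position u)) uv)

-- The diameter of the joined components

odd-decomposition : ∀ L → ¬ (2 ∣ L) → ∃[ k ] L ≡ suc (2 * k)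
odd-decomposition L 2∤L with L % 2 in eq | m≡m%n+[m/n]*n L 2 | m%n<n L 2
... | 0 | _ | _ = contradiction (m%n≡0⇒n∣m L 2 eq) 2∤L
... | 1 | L≡ | _ = L / 2 , trans L≡ (cong suc (*-comm (L / 2) 2))
... | suc (suc _) | _ | s≤s (s≤s ())

theorem40 : (p : ℕ) → Prime p → (p % 120 ≡ 71 ⊎ p % 120 ≡ 119) →
    (𝔭 : PrimeAbove2 p) (L : ℕ) → IsOrd p 𝔭 L → ¬ (2 ∣ L) → 3 ≤ L →
    (T₁ T₂ : StackedComponent L) →
    let open StackedComponent in
    (a : Vertex T₁) (b : Vertex T₂) → Floor T₁ a → Floor T₂ b →
    IsDiameter (join (graph T₁) (graph T₂) a b) (L + 4)
theorem40 _ _ _ _ L _ 2∤L 3≤L T₁ T₂ a b fa fb with odd-decomposition L 2∤L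
-- Here `L` would be 1, against `3 ≤ L`; the remaining case supplies `1 ≤ k`.
... | zero , refl = contradiction 3≤L λ { (s≤s ()) }
... | k@(suc _) , refl = subst (IsDiameter _) (total k)
  (join-diameter (graph T₁) (graph T₂) a b C₁.dist-distances C₂.dist-distances
    O₁.dist≤ O₂.dist≤
    (let u , ua , _ = O₁.farthest a fa in u , ua)
    (let v , _ , bv = O₂.farthest b fb in v , bv))
  where
  open StackedComponent
  module C₁ = Component T₁
  module C₂ = Component T₂
  module O₁ = OddComponent {k} (s≤s z≤n) T₁
  module O₂ = OddComponent {k} (s≤s z≤n) T₂
  total : ∀ k → 2 + k + suc (2 + k) ≡ suc (2 * k) + 4
  total = solve-∀
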